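{- Let $\mathcal{G}=(W,\leq,R_{N_1},R_{N_2})$ be an $\hat N$-frame. Define $Y_0:=\{z\in W: \text{there is no } x\in W\text{ with } zR_{N_2}x\}$. Then: 1. For all $x,y\in W$: (a) $xR_{N_2}y$ iff $\exists z\in W(x\leq z\ \&\ y\leq z\ \&\ z\notin Y_0)$; (b) $xR_{N_1}y$ iff $\exists z\in W(x\leq z\ \&\ y\leq z)$. 2. $\Psi(\mathcal{G}):=(W,\leq,Y_0)$ is a sub-normal frame. If $\mathcal{G}$ is an $\hat N'$-frame, then $\Psi(\mathcal{G})$ is a sub-normal identity frame. 3. If $v$ is a valuation on $\mathcal{G}$, then $v$ is a valuation on $\Psi(\mathcal{G})$ such that for all $\alpha\in F$ and $x\in W$: (a) $(\mathcal{G},v),x\vDash\alpha\Leftrightarrow(\Psi(\mathcal{G}),v),x\vDash\alpha$; (b) $(\mathcal{G},v)\vDash\alpha\Leftrightarrow(\Psi(\mathcal{G}),v)\vDash\alpha$; (c) $\mathcal{G}\vDash\alpha\Leftrightarrow\Psi(\mathcal{G})\vDash\alpha$.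
   Context: $F$ is the set of formulas built from propositional variables and constants $\top,\bot$ with $\wedge,\vee,\rightarrow,\neg,\sim$. A sub-normal frame is $(W,\leq,Y_0)$ with $(W,\leq)$ a nonempty poset and $Y_0\subseteq W$ an upset such that for all $x\in W$: if for every $y\geq x$ there is $z\geq y$ with $z\in Y_0$, then $x\in Y_0$. It is a sub-normal identity frame if moreover for all $x,y\in W\setminus Y_0$, $x\leq y$ implies $y\leq x$. A strictly condensed $J$-frame is a triple $(X,\leq,R_N)$ with $(X,\leq)$ a nonempty poset and $R_N$ a binary relation on $X$ such that: (i) $x\leq x'$, $x'R_Ny'$, $y\leq y'$ imply $xR_Ny$; (ii) $R_N$ is symmetric; (iii) $\forall x,y\,(xR_Ny\Rightarrow\exists z(x\leq z\ \&\ y\leq z\ \&\ xR_Nz))$. It is a strictly condensed $H$-frame if moreover $R_N$ is reflexive. An $\hat N$-frame is $(X,\leq,R_{N_1},R_{N_2})$ such that (1) $(X,\leq,R_{N_1})$ is a strictly condensed $H$-frame; (2) $(X,\leq,R_{N_2})$ is a strictly condensed $J$-frame; (3) for all $x\in X$: if for every $y$ with $xR_{N_1}y$ there is $z$ with $yR_{N_1}z$ and no $z'$ with $zR_{N_2}z'$, then there is no $z''$ with $xR_{N_2}z''$. An $\hat N'$-frame is an $\hat N$-frame such that $xR_{N_2}y$ implies $y\leq x$. On either kind of frame, a valuation assigns an upset to each propositional variable. Truth: variables via $v$; $\top$ everywhere, $\bot$ nowhere; $\wedge,\vee$ pointwise; $x\vDash\alpha\rightarrow\beta$ iff for all $y\geq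 x$, $y\vDash\alpha$ implies $y\vDash\beta$. On sub-normal frames: $x\vDash\neg\alpha$ iff for all $y\geq x$, $y\nvDash\alpha$; $x\vDash\sim\alpha$ iff for all $y\geq x$, $y\vDash\alpha$ implies $y\in Y_0$. On $\hat N$-frames: $x\vDash\neg\alpha$ iff for all $y$, $xR_{N_1}y$ implies $y\nvDash\alpha$; $x\vDash\sim\alpha$ iff for all $y$, $xR_{N_2}y$ implies $y\nvDash\alpha$. $(\mathcal{G},v)\vDash\alpha$ means truth at all points; $\mathcal{G}\vDash\alpha$ means truth at all points under all valuations. -}

module Defs where

open import Level using (Level; suc; _⊔_)
open import Data.Empty.Polymorphic using (⊥)
open import Data.Product using (∃; _×_)
open import Data.Sum using (_⊎_)
open import Data.Unit.Polymorphic using (⊤)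
open import Relation.Binary.Bundles using (Poset)
open import Relation.Binary.Core using (Rel)
open import Relation.Binary.Definitions using (Reflexive; Symmetric; _Respects_)
open import Relation.Nullary using (¬_)
open import Relation.Unary using (Pred)

infixr 7 _∧′_
infixr 6 _∨′_
infixr 5 _⇒′_
infix  8 ¬′_ ∼′_

data Formula {a} (Var : Set a) : Set a where
  var            : Var → Formula Var
  ⊤′ ⊥′          : Formula Var
  _∧′_ _∨′_ _⇒′_ : (α β : Formula Var) → Formula Var
  ¬′_ ∼′_        : (α : Formula Var) → Formula Var

-- Posets, relations, subsets and valuations all live in one universe level ℓ,
-- which plays the role of the universe of sets.

record SubNormalStructure ℓ : Set (suc ℓ) where
  field
    poset : Poset ℓ ℓ ℓ
  open Poset poset public using (Carrier; _≤_)
  field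
    Y₀ : Pred Carrier ℓ

record N̂Structure ℓ : Set (suc ℓ) where
  field
    poset : Poset ℓ ℓ ℓ
  open Poset poset public using (Carrier; _≤_)
  field
    R₁ R₂ : Rel Carrier ℓ

module _ {ℓ} (S : SubNormalStructure ℓ) where
  open SubNormalStructure S

  record IsSubNormalFrame : Set ℓ where
    field
      nonempty : Carrier
      Y₀-upset : Y₀ Respects _≤_
      Y₀-dense : ∀ x → (∀ y → x ≤ y → ∃ λ z → y ≤ z × Y₀ z) → Y₀ x

  record IsSubNormalIdentityFrame : Set ℓ where
    field
      isSubNormalFrame : IsSubNormalFrame
      ≤-sym-off-Y₀     : ∀ x y → ¬ Y₀ x → ¬ Y₀ y → x ≤ y → y ≤ x

module _ {ℓ} (P : Poset ℓ ℓ ℓ) (R : Rel (Poset.Carrier P) ℓ) where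
  open Poset P using (Carrier; _≤_)

  record IsStrictlyCondensedJFrame : Set ℓ where
    field
      nonempty  : Carrier
      condensed : ∀ x x′ y y′ → x ≤ x′ → R x′ y′ → y ≤ y′ → R x y
      R-sym     : Symmetric R
      strict    : ∀ x y → R x y → ∃ λ z → x ≤ z × y ≤ z × R x z

  record IsStrictlyCondensedHFrame : Set ℓ where
    field
      isStrictlyCondensedJFrame : IsStrictlyCondensedJFrame
      R-refl                    : Reflexive R

module _ {ℓ} (G : N̂Structure ℓ) where
  open N̂Structure G

  record IsN̂Frame : Set ℓ where
    field
      R₁-isHFrame : IsStrictlyCondensedHFrame poset R₁
      R₂-isJFrame : IsStrictlyCondensedJFrame poset R₂
      R₁-R₂       : ∀ x →
        (∀ y → R₁ x y → ∃ λ z → R₁ y z × ¬ (∃ λ z′ → R₂ z z′)) →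
        ¬ (∃ λ z″ → R₂ x z″)

  record IsN̂′Frame : Set ℓ where
    field
      isN̂Frame : IsN̂Frame
      R₂⇒≥     : ∀ x y → R₂ x y → y ≤ x

  Ψ : SubNormalStructure ℓ
  Ψ = record
    { poset = poset
    ; Y₀    = λ z → ¬ (∃ λ x → R₂ z x)
    }

module _ {a ℓ : Level} {Var : Set a} where

  IsValuation : (P : Poset ℓ ℓ ℓ) → (Var → Pred (Poset.Carrier P) ℓ) → Set (a ⊔ ℓ)
  IsValuation P v = ∀ p → v p Respects Poset._≤_ P

  module _ (S : SubNormalStructure ℓ) where
    open SubNormalStructure S

    module _ (v : Var → Pred Carrier ℓ) where

      SubNormalTrueAt : Carrier → Formula Var → Set ℓ
      SubNormalTrueAt x (var p)  = v p x
      SubNormalTrueAt x ⊤′       = ⊤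
      SubNormalTrueAt x ⊥′       = ⊥
      SubNormalTrueAt x (α ∧′ β) = SubNormalTrueAt x α × SubNormalTrueAt x β
      SubNormalTrueAt x (α ∨′ β) = SubNormalTrueAt x α ⊎ SubNormalTrueAt x β
      SubNormalTrueAt x (α ⇒′ β) = ∀ y → x ≤ y → SubNormalTrueAt y α → SubNormalTrueAt y β
      SubNormalTrueAt x (¬′ α)   = ∀ y → x ≤ y → ¬ SubNormalTrueAt y α
      SubNormalTrueAt x (∼′ α)   = ∀ y → x ≤ y → SubNormalTrueAt y α → Y₀ y

      SubNormalTrue : Formula Var → Set ℓ
      SubNormalTrue α = ∀ x → SubNormalTrueAt x α

    SubNormalValid : Formula Var → Set (a ⊔ suc ℓ)
    SubNormalValid α = ∀ v → IsValuation poset v → SubNormalTrue v α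

  module _ (G : N̂Structure ℓ) where
    open N̂Structure G

    module _ (v : Var → Pred Carrier ℓ) where

      N̂TrueAt : Carrier → Formula Var → Set ℓ
      N̂TrueAt x (var p)  = v p x
      N̂TrueAt x ⊤′       = ⊤
      N̂TrueAt x ⊥′       = ⊥
      N̂TrueAt x (α ∧′ β) = N̂TrueAt x α × N̂TrueAt x β
      N̂TrueAt x (α ∨′ β) = N̂TrueAt x α ⊎ N̂TrueAt x β
      N̂TrueAt x (α ⇒′ β) = ∀ y → x ≤ y → N̂TrueAt y α → N̂TrueAt y β
      N̂TrueAt x (¬′ α)   = ∀ y → R₁ x y → ¬ N̂TrueAt y α
      N̂TrueAt x (∼′ α)   = ∀ y → R₂ x y → ¬ N̂TrueAt y α

      N̂True : Formula Var → Set ℓ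
      N̂True α = ∀ x → N̂TrueAt x α

    N̂Valid : Formula Var → Set (a ⊔ suc ℓ)
    N̂Valid α = ∀ v → IsValuation poset v → N̂True v α

{-# OPTIONS --safe #-}
-- Since R₂ is downward closed in both arguments, a point off Y₀ above x and y
-- makes x R₂ y, and strictness gives the converse; likewise R₁ is "having a
-- common upper bound".  Thus both relations are recovered from ≤ and Y₀, and the
-- clauses for ¬ and ∼ in the two semantics agree because truth is persistent:
-- α true at y stays true at the common upper bound.
module Submission where

open import Defs
open import Axiom.ExcludedMiddle using (ExcludedMiddle)
open import Axiom.DoubleNegationElimination using (em⇒dne)
open import Data.Product using (∃; _×_; _,_) renaming (map to ×-map)
open import Data.Sum using () renaming (map to ⊎-map)
open import Function.Base using (id; _∘_)
open import Function.Bundles using (_⇔_; mk⇔; module Equivalence)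
open import Relation.Binary.Bundles using (Poset)
open import Relation.Nullary using (¬_)
open import Relation.Unary using (Pred)

open Equivalence using (to; from)

module _ {a ℓ} {Var : Set a} (S : SubNormalStructure ℓ) (S-frame : IsSubNormalFrame S) where
  open SubNormalStructure S
  open Poset poset using (trans)
  open IsSubNormalFrame S-frame

  -- The clauses for `⇒′`, `¬′` and `∼′` quantify over all points above, so transitivity settles
  -- them; only `∧′` and `∨′` recurse.
  persistent : (v : Var → Pred Carrier ℓ) → IsValuation poset v →
    ∀ α {x y} → x ≤ y → SubNormalTrueAt S v x α → SubNormalTrueAt S v y α
  persistent v val (var p)  x≤y = val p x≤y
  persistent v val ⊤′       x≤y = id
  persistent v val ⊥′       x≤y = id
  persistent v val (α ∧′ β) x≤y = ×-map (persistent v val α x≤y) (persistent v val β x≤y)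
  persistent v val (α ∨′ β) x≤y = ⊎-map (persistent v val α x≤y) (persistent v val β x≤y)
  persistent v val (α ⇒′ β) x≤y h z y≤z = h z (trans x≤y y≤z)
  persistent v val (¬′ α)   x≤y h z y≤z = h z (trans x≤y y≤z)
  persistent v val (∼′ α)   x≤y h z y≤z = h z (trans x≤y y≤z)

module _ {ℓ} (em : ExcludedMiddle ℓ) (G : N̂Structure ℓ) (G-frame : IsN̂Frame G) where
  open N̂Structure G
  open SubNormalStructure (Ψ G) using (Y₀)
  open Poset poset using (refl; trans)
  open IsN̂Frame G-frame
  private
    module H = IsStrictlyCondensedHFrame R₁-isHFrame
    module J₁ = IsStrictlyCondensedJFrame H.isStrictlyCondensedJFrame
    module J₂ = IsStrictlyCondensedJFrame R₂-isJFrame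

  R₁⇔bounded : ∀ x y → R₁ x y ⇔ (∃ λ z → x ≤ z × y ≤ z)
  R₁⇔bounded x y = mk⇔
    (λ xR₁y → let z , x≤z , y≤z , _ = J₁.strict x y xR₁y in z , x≤z , y≤z)
    -- Reflexivity gives `R₁ z z`, which is pulled down to `x` and `y`.
    (λ (z , x≤z , y≤z) → J₁.condensed x z y z x≤z H.R-refl y≤z)

  R₂⇔bounded-off-Y₀ : ∀ x y → R₂ x y ⇔ (∃ λ z → x ≤ z × y ≤ z × ¬ Y₀ z)
  R₂⇔bounded-off-Y₀ x y = mk⇔
    (λ xR₂y → let z , x≤z , y≤z , xR₂z = J₂.strict x y xR₂y in
      -- By symmetry `x` is an `R₂`-successor of `z`, which keeps `z` off `Y₀`.
      z , x≤z , y≤z , λ z∈Y₀ → z∈Y₀ (x , J₂.R-sym xR₂z))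
    (λ (z , x≤z , y≤z , z∉Y₀) →
      -- `¬ Y₀ z` is a doubly negated existential; excluded middle extracts a successor `w`.
      -- Strictness then trades `w` for some `u` above `z`, hence above `y`.
      let w , zR₂w = em⇒dne em z∉Y₀
          u , z≤u , _ , zR₂u = J₂.strict z w zR₂w
      in J₂.condensed x z y u x≤z zR₂u (trans y≤z z≤u))

  Ψ-isSubNormalFrame : IsSubNormalFrame (Ψ G)
  Ψ-isSubNormalFrame = record
    { nonempty = J₂.nonempty
    ; Y₀-upset = λ {x} {y} x≤y x∈Y₀ (w , yR₂w) →
        x∈Y₀ (w , J₂.condensed x y w w x≤y yR₂w refl)
    -- Density is applied at a common upper bound `u` of `x` and `y`; the point of `Y₀` it yields
    -- lies above `y`, so it is `R₁`-related to `y`.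
    ; Y₀-dense = λ x dense → R₁-R₂ x λ y xR₁y →
        let u , x≤u , y≤u = to (R₁⇔bounded x y) xR₁y
            z , u≤z , z∈Y₀ = dense u x≤u
        in z , from (R₁⇔bounded y z) (z , trans y≤u u≤z , refl) , z∈Y₀
    }

  Ψ-isSubNormalIdentityFrame : IsN̂′Frame G → IsSubNormalIdentityFrame (Ψ G)
  Ψ-isSubNormalIdentityFrame G′ = record
    { isSubNormalFrame = Ψ-isSubNormalFrame
    -- Here `y` is itself a common upper bound off `Y₀`, whence `R₂ x y`.
    ; ≤-sym-off-Y₀     = λ x y _ y∉Y₀ x≤y →
        IsN̂′Frame.R₂⇒≥ G′ x y (from (R₂⇔bounded-off-Y₀ x y) (y , x≤y , refl , y∉Y₀))
    }

  module _ {a} {Var : Set a} where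

    truth⇔ : (v : Var → Pred Carrier ℓ) → IsValuation poset v →
      ∀ α x → N̂TrueAt G v x α ⇔ SubNormalTrueAt (Ψ G) v x α
    truth⇔ v val (var p)  x = mk⇔ id id
    truth⇔ v val ⊤′       x = mk⇔ id id
    truth⇔ v val ⊥′       x = mk⇔ id id
    truth⇔ v val (α ∧′ β) x = mk⇔
      (×-map (to (truth⇔ v val α x)) (to (truth⇔ v val β x)))
      (×-map (from (truth⇔ v val α x)) (from (truth⇔ v val β x)))
    truth⇔ v val (α ∨′ β) x = mk⇔
      (⊎-map (to (truth⇔ v val α x)) (to (truth⇔ v val β x)))
      (⊎-map (from (truth⇔ v val α x)) (from (truth⇔ v val β x)))
    truth⇔ v val (α ⇒′ β) x = mk⇔
      (λ h y x≤y → to (truth⇔ v val β y) ∘ h y x≤y ∘ from (truth⇔ v val α y))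
      (λ h y x≤y → from (truth⇔ v val β y) ∘ h y x≤y ∘ to (truth⇔ v val α y))
    truth⇔ v val (¬′ α)   x = mk⇔
      (λ h y x≤y → h y (from (R₁⇔bounded x y) (y , x≤y , refl)) ∘ from (truth⇔ v val α y))
      (λ h y xR₁y y⊨α →
        let z , x≤z , y≤z = to (R₁⇔bounded x y) xR₁y
        -- Truth of `α` at `y` is first carried over to `Ψ G`, where persistence lifts it to `z`.
        in h z x≤z (persistent (Ψ G) Ψ-isSubNormalFrame v val α y≤z (to (truth⇔ v val α y) y⊨α)))
    truth⇔ v val (∼′ α)   x = mk⇔
      -- The goal `Y₀ y` is a negation: a successor of `y` is assumed, and it puts `y` off `Y₀`.
      (λ h y x≤y y⊨α yR₂ →
        h y (from (R₂⇔bounded-off-Y₀ x y) (y , x≤y , refl , λ y∈Y₀ → y∈Y₀ yR₂))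
          (from (truth⇔ v val α y) y⊨α))
      (λ h y xR₂y y⊨α →
        let z , x≤z , y≤z , z∉Y₀ = to (R₂⇔bounded-off-Y₀ x y) xR₂y
        in z∉Y₀ (h z x≤z
             (persistent (Ψ G) Ψ-isSubNormalFrame v val α y≤z (to (truth⇔ v val α y) y⊨α))))

    true⇔ : (v : Var → Pred Carrier ℓ) → IsValuation poset v →
      ∀ α → N̂True G v α ⇔ SubNormalTrue (Ψ G) v α
    true⇔ v val α = mk⇔
      (λ h x → to (truth⇔ v val α x) (h x))
      (λ h x → from (truth⇔ v val α x) (h x))

    -- `Ψ` keeps the poset, so both sides range over the same valuations.
    valid⇔ : (α : Formula Var) → N̂Valid G α ⇔ SubNormalValid (Ψ G) α
    valid⇔ α = mk⇔
      (λ h v val → to (true⇔ v val α) (h v val))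
      (λ h v val → from (true⇔ v val α) (h v val))

theorem5p5 : ∀ {a ℓ} {Var : Set a} → ExcludedMiddle ℓ →
  (G : N̂Structure ℓ) → IsN̂Frame G →
  let open N̂Structure G
      open SubNormalStructure (Ψ G) using (Y₀)
  in
    (∀ x y → (R₂ x y ⇔ (∃ λ z → x ≤ z × y ≤ z × ¬ Y₀ z))
           × (R₁ x y ⇔ (∃ λ z → x ≤ z × y ≤ z)))
  × (IsSubNormalFrame (Ψ G) × (IsN̂′Frame G → IsSubNormalIdentityFrame (Ψ G)))
  × (∀ (v : Var → Pred Carrier ℓ) → IsValuation poset v →
       IsValuation (SubNormalStructure.poset (Ψ G)) v
     × (∀ (α : Formula Var) →
          (∀ x → N̂TrueAt G v x α ⇔ SubNormalTrueAt (Ψ G) v x α)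
        × (N̂True G v α ⇔ SubNormalTrue (Ψ G) v α)
        × (N̂Valid G α ⇔ SubNormalValid (Ψ G) α)))
theorem5p5 em G G-frame =
    (λ x y → R₂⇔bounded-off-Y₀ em G G-frame x y , R₁⇔bounded em G G-frame x y)
  , (Ψ-isSubNormalFrame em G G-frame , Ψ-isSubNormalIdentityFrame em G G-frame)
  , λ v val → val , λ α →
      truth⇔ em G G-frame v val α , true⇔ em G G-frame v val α , valid⇔ em G G-frame α
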